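{- (Preservation) Let $\phi=\phi(x)$ be a formula of $L_{\infty\omega}^{corr}$ and $K$ a class of Routley–Meyer structures defined by some sentence $\psi$ of $L_{\infty\omega}^{corr}$. Then $\phi$ is preserved under relevant directed bisimulations in $K$ if and only if $\phi$ is equivalent to an infinitary relevant formula over $K$, i.e. there is a formula $\theta$ of $L_{\infty\omega}^{\rightarrow}$ such that for every $M\in K$ and every world $w$ of $M$, $M\vDash\phi[w]$ iff $M,w\Vdash\theta$.
   Context: Language. Given a set $\mathtt{PROP}$ of propositional variables, the formulas of $L_{\infty\omega}^{\rightarrow}$ (infinitary relevant formulas) are generated by $\phi ::= p \mid \bot \mid {\sim}\phi \mid \bigwedge_{i\in I}\phi_i \mid \bigvee_{i\in I}\phi_i \mid \phi\rightarrow\psi$, with $p\in\mathtt{PROP}$ and $I$ an arbitrary set. Models. A (Routley–Meyer) model or structure is $M=\langle W,R,*,T,V\rangle$ with $W$ a non-empty set, $T\in W$, $*:W\to W$ (written $w\mapsto w^*$), $R\subseteq W^3$, and $V:\mathtt{PROP}\to\wp(W)$. Satisfaction: $M,w\Vdash\bot$ never; $M,w\Vdash p$ iff $w\in V(p)$; $M,w\Vdash{\sim}\phi$ iff $M,w^*\nVdash\phi$; $M,w\Vdash\bigwedge_{i\in I}\phi_i$ iff $M,w\Vdash\phi_i$ for every $i\in I$; $M,w\Vdash\bigvee_{i\in I}\phi_i$ iff $M,w\Vdash\phi_i$ for some $i\in I$; $M,w\Vdash\phi\rightarrow\psi$ iff for all $a,b$ with $Rwab$, if $M,a\Vdash\phi$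 then $M,b\Vdash\psi$. Correspondence language. $L_{\infty\omega}^{corr}$ is the classical infinitary language with equality (arbitrary set-sized conjunctions and disjunctions, boolean negation, finitary quantification) in the signature with a constant $T$, a unary function symbol $*$, a ternary relation symbol $R$ and a unary predicate $P$ for each $p\in\mathtt{PROP}$. A model $M$ is read as a classical structure with domain $W$, interpreting $T,*,R$ in the obvious way and $P$ by $V(p)$; $M\vDash\chi[w]$ is Tarskian satisfaction with $w$ assigned to the free variable $x$. Relevant directed bisimulations. Let $M_1,M_2$ be models with components $W_m,R_m,*_m,V_m$ ($m=1,2$). A relevant directed bisimulation (for $\mathtt{PROP}$) between $M_1$ and $M_2$ is a pair $\langle Z_1,Z_2\rangle$ of non-empty relations $Z_1\subseteq W_1\times W_2$, $Z_2\subseteq W_2\times W_1$ such that whenever $\{i,j\}=\{1,2\}$: (1) $xZ_iy$ only if $y^{*_j}Z_jx^{*_i}$; (2) if $xZ_iy$ and $R_jybc$ for some $b,c\in W_j$, there are $b',c'\in W_i$ such that $R_ixb'c'$, $bZ_jb'$ and $c'Z_ic$; (3) if $xZ_iy$ and $p\in\mathtt{PROP}$, then $M_i,x\Vdash p$ only if $M_j,y\Vdash p$. $\phi$ is preserved under relevant directed bisimulations in $K$ if whenever $M_1,M_2\in K$, $\langle Z_1,Z_2\rangle$ is a relevant directed bisimulation between $M_1$ and $M_2$, $\{i,j\}=\{1,2\}$ and $aZ_ib$, then $M_i\vDash\phi[a]$ only if $M_j\vDash\phi[b]$. -}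

module Defs where

open import Level using (Level; suc)
open import Data.Empty.Polymorphic using (⊥)
open import Data.Fin using (Fin)
open import Data.Nat as ℕ using (ℕ)
open import Data.Product using (∃; ∃₂; _×_)
open import Data.Vec using (Vec; []; _∷_; lookup)
open import Function.Bundles using (_⇔_)
open import Relation.Binary.Core using (REL)
open import Relation.Binary.PropositionalEquality using (_≡_)
open import Relation.Nullary using (¬_)
open import Relation.Unary using (Pred; _∈_)

-- `Set ℓ` plays the role of the sets, and `Set (suc ℓ)` that of the classes:
-- PROP, the domains of structures and the index sets of ⋀ and ⋁ all live in
-- `Set ℓ`, so structures and formulas form (large) types in `Set (suc ℓ)`.

-- Terms of the correspondence language, with free variables among n.

data Term (n : ℕ) : Set where
  var : Fin n → Term n
  cst : Term n           -- the constant T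
  _*  : Term n → Term n

module _ {ℓ : Level} (PROP : Set ℓ) where

  infixr 6 _⇒_

  data RelevantFormula : Set (suc ℓ) where
    atom : PROP → RelevantFormula
    bot  : RelevantFormula
    ∼_   : RelevantFormula → RelevantFormula
    ⋀ ⋁  : {I : Set ℓ} → (I → RelevantFormula) → RelevantFormula
    _⇒_  : RelevantFormula → RelevantFormula → RelevantFormula

  -- De Bruijn representation: a quantifier binds variable 0.

  data CorrFormula (n : ℕ) : Set (suc ℓ) where
    _≐_ : Term n → Term n → CorrFormula n
    rel : Term n → Term n → Term n → CorrFormula n
    prd : PROP → Term n → CorrFormula n
    neg : CorrFormula n → CorrFormula n
    ⋀ ⋁ : {I : Set ℓ} → (I → CorrFormula n) → CorrFormula n
    all ex : CorrFormula (ℕ.suc n) → CorrFormula n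

  -- W is non-empty because of T.

  record Structure : Set (suc ℓ) where
    field
      W    : Set ℓ
      R    : W → W → W → Set ℓ
      star : W → W
      T    : W
      V    : PROP → Pred W ℓ

module _ {ℓ : Level} {PROP : Set ℓ} where

  open Structure

  infix 3 _∣_⊩_ _⊨_[_]

  _∣_⊩_ : (M : Structure PROP) → W M → RelevantFormula PROP → Set ℓ
  M ∣ w ⊩ atom p  = w ∈ V M p
  M ∣ w ⊩ bot     = ⊥
  M ∣ w ⊩ (∼ φ)   = ¬ (M ∣ star M w ⊩ φ)
  M ∣ w ⊩ ⋀ φ     = ∀ i → M ∣ w ⊩ φ i
  M ∣ w ⊩ ⋁ φ     = ∃ λ i → M ∣ w ⊩ φ i
  M ∣ w ⊩ (φ ⇒ ψ) = ∀ a b → R M w a b → M ∣ a ⊩ φ → M ∣ b ⊩ ψ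

  ⟦_⟧ : ∀ {n} → Term n → (M : Structure PROP) → Vec (W M) n → W M
  ⟦ var i ⟧ M ρ = lookup ρ i
  ⟦ cst ⟧   M ρ = T M
  ⟦ t * ⟧   M ρ = star M (⟦ t ⟧ M ρ)

  _⊨_[_] : ∀ {n} (M : Structure PROP) → CorrFormula PROP n → Vec (W M) n → Set ℓ
  M ⊨ s ≐ t [ ρ ]   = ⟦ s ⟧ M ρ ≡ ⟦ t ⟧ M ρ
  M ⊨ rel s t u [ ρ ] = R M (⟦ s ⟧ M ρ) (⟦ t ⟧ M ρ) (⟦ u ⟧ M ρ)
  M ⊨ prd p t [ ρ ] = ⟦ t ⟧ M ρ ∈ V M p
  M ⊨ neg χ [ ρ ]   = ¬ (M ⊨ χ [ ρ ])
  M ⊨ ⋀ χ [ ρ ]     = ∀ i → M ⊨ χ i [ ρ ]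
  M ⊨ ⋁ χ [ ρ ]     = ∃ λ i → M ⊨ χ i [ ρ ]
  M ⊨ all χ [ ρ ]   = ∀ w → M ⊨ χ [ w ∷ ρ ]
  M ⊨ ex χ [ ρ ]    = ∃ λ w → M ⊨ χ [ w ∷ ρ ]

  Mod : CorrFormula PROP 0 → Pred (Structure PROP) ℓ
  Mod ψ M = M ⊨ ψ [ [] ]

  -- The back-and-forth conditions for one of the two choices of i and j
  -- with {i,j} = {1,2}; Z is Zᵢ and Z′ is Zⱼ.

  record Directed (Mᵢ Mⱼ : Structure PROP)
                  (Z  : REL (W Mᵢ) (W Mⱼ) ℓ)
                  (Z′ : REL (W Mⱼ) (W Mᵢ) ℓ) : Set ℓ where
    field
      star-back : ∀ {x y} → Z x y → Z′ (star Mⱼ y) (star Mᵢ x)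
      R-back    : ∀ {x y b c} → Z x y → R Mⱼ y b c →
                  ∃₂ λ b′ c′ → R Mᵢ x b′ c′ × Z′ b b′ × Z c′ c
      atoms     : ∀ {x y} → Z x y → ∀ p → Mᵢ ∣ x ⊩ atom p → Mⱼ ∣ y ⊩ atom p

  record IsRelevantDirectedBisimulation
           (M₁ M₂ : Structure PROP)
           (Z₁ : REL (W M₁) (W M₂) ℓ)
           (Z₂ : REL (W M₂) (W M₁) ℓ) : Set ℓ where
    field
      nonempty₁ : ∃₂ Z₁
      nonempty₂ : ∃₂ Z₂
      directed₁ : Directed M₁ M₂ Z₁ Z₂
      directed₂ : Directed M₂ M₁ Z₂ Z₁

  PreservedUnderRelevantDirectedBisimulations :
    Pred (Structure PROP) ℓ → CorrFormula PROP 1 → Set (suc ℓ)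
  PreservedUnderRelevantDirectedBisimulations K φ =
    ∀ {M₁ M₂ : Structure PROP} → M₁ ∈ K → M₂ ∈ K →
    ∀ {Z₁ Z₂} → IsRelevantDirectedBisimulation M₁ M₂ Z₁ Z₂ →
    (∀ {a b} → Z₁ a b → M₁ ⊨ φ [ a ∷ [] ] → M₂ ⊨ φ [ b ∷ [] ]) ×
    (∀ {a b} → Z₂ a b → M₂ ⊨ φ [ a ∷ [] ] → M₁ ⊨ φ [ b ∷ [] ])

  EquivalentOver : Pred (Structure PROP) ℓ →
                   CorrFormula PROP 1 → RelevantFormula PROP → Set (suc ℓ)
  EquivalentOver K φ θ =
    ∀ (M : Structure PROP) → M ∈ K →
    ∀ (w : W M) → (M ⊨ φ [ w ∷ [] ]) ⇔ (M ∣ w ⊩ θ)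

{-# OPTIONS --safe #-}

-- Suppose φ is preserved in K but equivalent to no relevant formula.  Then
-- for every set F of relevant formulas there are M, N in K and points
-- M ⊨ φ[w], N ⊭ φ[v] such that v satisfies every member of F true at w: else
-- the disjunction of the F-types realised by φ in K would define φ.  Taking
-- F = next(next(...)) yields arbitrarily long chains of relations between M
-- and N, each going back and forth into the following one.  As in the proof
-- that well-orderings are not definable in L∞ω, work in a set of Skolem terms
-- for ψ, φ and the back-and-forth conditions: by the pigeonhole principle over
-- the set of diagrams of these terms, chains of length 1, 2, 3, … can be taken
-- coherent.  Their limit is a pair of term models in K, in which the union of
-- the infinite chain is a directed bisimulation violating the preservation of φ.

module Submission where

open import Level using (Level; Lift; lift; lower) renaming (suc to lsuc)
open import Axiom.ExcludedMiddle using (ExcludedMiddle)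
open import Data.Bool using (Bool; true; false; if_then_else_) renaming (T to IsTrue)
open import Data.Empty.Polymorphic using (⊥)
open import Data.Fin using (zero; suc)
open import Data.Maybe using (Maybe; just; nothing)
open import Data.Nat using (ℕ; zero; suc; _⊔_; _≤_; _<_; z≤n; s≤s; _≤?_; _≤′_; ≤′-refl; ≤′-step)
open import Data.Nat.Properties
  using (≤-refl; ≤-trans; ≤-antisym; ≤-total; <⇒≤; 1+n≰n; m≤n⇒m<n∨m≡n;
         ≤⇒≤′; ≤′⇒≤; m≤m⊔n; m≤n⊔m; ⊔-lub; m⊔n≤o⇒m≤o; m⊔n≤o⇒n≤o)
open import Data.Product using (Σ; ∃; ∃₂; _×_; _,_; proj₁; proj₂; uncurry)
open import Data.Sum using (inj₁; inj₂)
open import Data.Vec using (Vec; []; _∷_; lookup; map)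
open import Data.Vec.Properties using (lookup-map)
open import Function using (_∘_; id)
open import Function.Bundles using (_⇔_; mk⇔; Equivalence)
open import Function.Construct.Composition using (_⇔-∘_)
open import Function.Construct.Symmetry using (⇔-sym)
open import Relation.Binary.PropositionalEquality
  using (_≡_; refl; sym; trans; cong; cong₂; subst; subst₂)
open import Relation.Binary.PropositionalEquality.WithK using (≡-irrelevant)
open import Relation.Nullary using (¬_; yes; no; contradiction)
open import Relation.Nullary.Decidable
  using (map′; decidable-stable; ⌊_⌋; toWitness; fromWitness)
open import Relation.Unary using (Pred; _∈_)
open import Defs

open Structure
open Equivalence using (to; from)

-- Preservation of relevant formulas

module _ {ℓ : Level} {PROP : Set ℓ} where

  -- Negation and implication reverse the direction, so both halves of the bisimulation are used: an
  -- antecedent travels back along `Z′`, the consequent forward along `Z`.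
  relevant-preserved :
    ∀ (θ : RelevantFormula PROP) {M N : Structure PROP} {Z Z′} →
    Directed M N Z Z′ → Directed N M Z′ Z →
    ∀ {x y} → Z x y → M ∣ x ⊩ θ → N ∣ y ⊩ θ
  relevant-preserved (atom p) d d′ z = Directed.atoms d z p
  relevant-preserved bot      d d′ z ()
  relevant-preserved (∼ θ)    d d′ z h h′ =
    h (relevant-preserved θ d′ d (Directed.star-back d z) h′)
  relevant-preserved (⋀ θ)    d d′ z h i       = relevant-preserved (θ i) d d′ z (h i)
  relevant-preserved (⋁ θ)    d d′ z (i , h)   = i , relevant-preserved (θ i) d d′ z h
  relevant-preserved (θ ⇒ θ′) d d′ z h b c Rbc hb =
    let b′ , c′ , Rb′c′ , zb , zc = Directed.R-back d z Rbc
    in relevant-preserved θ′ d d′ zc (h b′ c′ Rb′c′ (relevant-preserved θ d′ d zb hb))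

module _ {ℓ : Level} (em : ExcludedMiddle (lsuc ℓ)) where

  em₀ : ExcludedMiddle ℓ
  em₀ = map′ lower lift (em {Lift (lsuc ℓ) _})

  -- Excluded middle for arbitrary types, not only propositions, yields choice.

  abstract
    ε : {A : Set ℓ} → Pred A ℓ → A → A
    ε P a with em₀ {∃ P}
    ... | yes (x , _) = x
    ... | no  _       = a

    ε-spec : {A : Set ℓ} (P : Pred A ℓ) (a : A) → ∃ P → P (ε P a)
    ε-spec P a h with em₀ {∃ P}
    ... | yes (_ , p) = p
    ... | no  ¬h      = contradiction h ¬h

  Least : Pred ℕ ℓ → Pred ℕ ℓ
  Least P n = P n × (∀ m → P m → n ≤ m)

  least : (P : Pred ℕ ℓ) (n : ℕ) → P n → ∃ (Least P)
  least P zero    p = zero , p , λ _ _ → z≤n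
  least P (suc n) p with em₀ {P zero}
  ... | yes p₀ = zero , p₀ , λ _ _ → z≤n
  ... | no ¬p₀ with least (P ∘ suc) n p
  ...   | k , pk , min = suc k , pk , λ where
            zero    p₀ → contradiction p₀ ¬p₀
            (suc m) pm → s≤s (min m pm)

  module _ {PROP : Set ℓ} where

    -- Sets of relevant formulas and their refinement

    record Family : Set (lsuc ℓ) where
      field
        Index  : Set ℓ
        member : Index → RelevantFormula PROP

    open Family

    Preserves : Family → (M N : Structure PROP) → W M → W N → Set ℓ
    Preserves F M N x y = ∀ i → M ∣ x ⊩ member F i → N ∣ y ⊩ member F i

    infix 4 _⊑_

    _⊑_ : Family → Family → Set (lsuc ℓ)
    F ⊑ G = ∀ {M N x y} → Preserves G M N x y → Preserves F M N x y

    ⋃ : {J : Set ℓ} → (J → Family) → Family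
    ⋃ {J} F = record
      { Index  = Σ J (Index ∘ F)
      ; member = λ (j , i) → member (F j) i
      }

    ∅ : Family
    ∅ = record { Index = ⊥ ; member = λ () }

    -- Subsets are `Bool`-valued because predicates into `Set ℓ` would be too large to index a
    -- family.
    data NextIndex (I : Set ℓ) : Set ℓ where
      atomᵢ : PROP → NextIndex I
      ∼ᵢ    : I → NextIndex I
      ⇒ᵢ    : (I → Bool) → (I → Bool) → NextIndex I

    -- If S is the F-type of b and S′ the complement of the F-type of c, then
    -- R y b c refutes ⇒ᵢ S S′ at y; this is what yields R-back.

    next : Family → Family
    next F = record { Index = NextIndex (Index F) ; member = λ where
      (atomᵢ p)  → atom p
      (∼ᵢ i)     → ∼ member F i
      (⇒ᵢ S S′)  → ⋀ {I = Σ _ (IsTrue ∘ S)} (member F ∘ proj₁)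
                 ⇒ ⋁ {I = Σ _ (IsTrue ∘ S′)} (member F ∘ proj₁) }

    next-star : ∀ F {M N x y} → Preserves (next F) M N x y →
                Preserves F N M (star N y) (star M x)
    next-star F z i h = decidable-stable em₀ λ ¬h → z (∼ᵢ i) ¬h h

    -- If no pair worked, every `R`-successor pair of `x` whose first point satisfies all of `S`
    -- would satisfy some member of `S′` at the second; so `x`, hence `y`, would satisfy the
    -- implication, which `b` and `c` refute. The witnesses form one pair so that they can be chosen
    -- together.
    next-R : ∀ F {M N x y b c} → Preserves (next F) M N x y → R N y b c →
             ∃ λ ((b′ , c′) : W M × W M) →
               R M x b′ c′ × Preserves F N M b b′ × Preserves F M N c′ c
    next-R F {M} {N} {x} {y} {b} {c} z Rbc = decidable-stable em₀ λ none →
      let S  = λ i → ⌊ em₀ {N ∣ b ⊩ member F i} ⌋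
          S′ = λ i → ⌊ em₀ {¬ (N ∣ c ⊩ member F i)} ⌋
          j , hc = z (⇒ᵢ S S′)
            (λ b′ c′ Rb′c′ hb → decidable-stable em₀ λ ¬hc →
              none ((b′ , c′) , Rb′c′ ,
                (λ i h → hb (i , fromWitness h)) ,
                (λ i h → decidable-stable em₀ λ ¬h → ¬hc ((i , fromWitness ¬h) , h))))
            b c Rbc (λ (i , h) → toWitness h)
      in toWitness (proj₂ j) hc

    -- The bound on all bad choices is the union of the bounds, since τ
    -- ranges over a set.

    pigeonhole : {A : Set ℓ} (P : A → Family → Set (lsuc ℓ)) →
                 (∀ {τ F G} → F ⊑ G → P τ G → P τ F) →
                 (∀ F → ∃ λ τ → P τ F) → ∃ λ τ → ∀ F → P τ F
    pigeonhole {A} P anti h = decidable-stable em λ none →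
      let bad : ∀ τ → ∃ λ F → ¬ P τ F
          bad τ = decidable-stable em λ ¬bad →
            none (τ , λ F → decidable-stable em λ ¬p → ¬bad (F , ¬p))
          τ , p = h (⋃ (proj₁ ∘ bad))
      in proj₂ (bad τ) (anti (λ z i → z (τ , i)) p)

    -- Pairs of models on which φ differs

    module _ (ψ : CorrFormula PROP 0) (φ : CorrFormula PROP 1) where

      -- Indexed by `Bool`, so that terms, evaluation and both halves of the bisimulation are
      -- uniform in the side.
      record Pair : Set (lsuc ℓ) where
        field
          M    : Bool → Structure PROP
          M∈K  : ∀ s → M s ∈ Mod ψ
          pt   : ∀ s → W (M s)
          φ-true  : M true ⊨ φ [ pt true ∷ [] ]
          φ-false : ¬ (M false ⊨ φ [ pt false ∷ [] ])

      open Pair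

      -- The defining disjunction runs over the sets `S` containing the `F`-type of some φ-point in
      -- a model of ψ. A point satisfying all of `S` but not φ would form, with the realising point,
      -- the excluded pair.
      equivalent-if-separated : ∀ F →
        ¬ (∃ λ (P : Pair) → Preserves F (M P true) (M P false) (pt P true) (pt P false)) →
        ∃ (EquivalentOver (Mod ψ) φ)
      equivalent-if-separated F none = θ , λ M M∈K w → mk⇔
        (λ h → let S = λ i → ⌊ em₀ {M ∣ w ⊩ member F i} ⌋ in
          (S , fromWitness (M , w , M∈K , h , λ i h′ → fromWitness h′)) ,
          λ (i , h′) → toWitness h′)
        (λ ((S , r) , h) →
          let N , v , N∈K , hv , v⊆S = toWitness {a? = em {Realised S}} r
          in decidable-stable em₀ λ ¬h → none (record
               { M = λ { true → N ; false → M }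
               ; M∈K = λ { true → N∈K ; false → M∈K }
               ; pt = λ { true → v ; false → w }
               ; φ-true = hv ; φ-false = ¬h }
             , λ i h′ → h (i , v⊆S i h′)))
        where
        Realised : (Index F → Bool) → Set (lsuc ℓ)
        Realised S = ∃₂ λ (M : Structure PROP) (w : W M) → M ∈ Mod ψ ×
          (M ⊨ φ [ w ∷ [] ]) × (∀ i → M ∣ w ⊩ member F i → IsTrue (S i))

        θ : RelevantFormula PROP
        -- `Realised S` is too large for an index set; its truth value is not.
        θ = ⋁ {I = Σ (Index F → Bool) λ S → IsTrue ⌊ em {Realised S} ⌋}
              λ (S , _) → ⋀ {I = Σ _ (IsTrue ∘ S)} (member F ∘ proj₁)

      -- Skolem terms

      -- Formulas form a large type, but the occurrences of subformulas in one formula form a set;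
      -- this keeps the Skolem symbols, and with them the diagrams, in `Set ℓ`.
      Pos Below : ∀ {n} → CorrFormula PROP n → Set ℓ
      Pos χ = Maybe (Below χ)
      Below (_ ≐ _)     = ⊥
      Below (rel _ _ _) = ⊥
      Below (prd _ _)   = ⊥
      Below (neg χ)     = Pos χ
      Below (⋀ χ)       = ∃ λ i → Pos (χ i)
      Below (⋁ χ)       = ∃ λ i → Pos (χ i)
      Below (all χ)     = Pos χ
      Below (ex χ)      = Pos χ

      subformula : ∀ {n} (χ : CorrFormula PROP n) → Pos χ → ∃ (CorrFormula PROP)
      below : ∀ {n} (χ : CorrFormula PROP n) → Below χ → ∃ (CorrFormula PROP)
      subformula χ nothing  = _ , χ
      subformula χ (just q) = below χ q
      below (neg χ) q       = subformula χ q
      below (⋀ χ)   (i , q) = subformula (χ i) q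
      below (⋁ χ)   (i , q) = subformula (χ i) q
      below (all χ) q       = subformula χ q
      below (ex χ)  q       = subformula χ q

      -- The atomic formulas are included so that a diagram records equality, `R` and the valuation
      -- on terms, from which the limit structures are read off.
      data Axis : Set ℓ where
        ψ-axis φ-axis ≐-axis R-axis : Axis
        V-axis : PROP → Axis

      axis : Axis → ∃ (CorrFormula PROP)
      axis ψ-axis     = _ , ψ
      axis φ-axis     = _ , φ
      axis ≐-axis     = 2 , var zero ≐ var (suc zero)
      axis R-axis     = 3 , rel (var zero) (var (suc zero)) (var (suc (suc zero)))
      axis (V-axis p) = 1 , prd p (var zero)

      Symbol : Set ℓ
      Symbol = ∃ λ r → Pos (proj₂ (axis r))

      formula : Symbol → ∃ (CorrFormula PROP)
      formula (r , q) = subformula (proj₂ (axis r)) q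

      data Tm : Bool → Set ℓ where
        root T′ : ∀ {s} → Tm s
        _⋆      : ∀ {s} → Tm s → Tm s
        sk      : ∀ {s} (σ : Symbol) → Vec (Tm s) (proj₁ (formula σ)) → Tm s
        -- witnesses for R-back from relation i to relation suc i of the chain
        bf      : ∀ {s s′} → Bool → ℕ → Tm s → Tm s′ → Tm s′ → Tm s

      -- A bound on the indices of the families consulted in evaluation; `bf` at `i` uses family
      -- `suc i`. Terms of level at most `n` keep their values when a chain of length `n` is
      -- prolonged.
      level  : ∀ {s} → Tm s → ℕ
      levels : ∀ {s m} → Vec (Tm s) m → ℕ
      level root           = 0
      level T′             = 0
      level (t ⋆)          = level t
      level (sk σ ts)      = levels ts
      level (bf _ i x b c) = suc i ⊔ (level x ⊔ (level b ⊔ level c))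
      levels []       = 0
      levels (t ∷ ts) = level t ⊔ levels ts

      -- Ground statements and their evaluation

      data Ground : Set ℓ where
        holds : ∀ s (σ : Symbol) → Vec (Tm s) (proj₁ (formula σ)) → Ground
        related : ∀ s s′ → ℕ → Tm s → Tm s′ → Ground

      rank : Ground → ℕ
      rank (holds s σ ts)      = levels ts
      rank (related s s′ i x y) = i ⊔ (level x ⊔ level y)

      -- Universal formulas receive a counterexample, existential ones an instance; `T` is the
      -- default for the other symbols.
      skolem : ∀ (M : Structure PROP) {m} → CorrFormula PROP m → Vec (W M) m → W M
      skolem M (all χ) ρ = ε (λ w → ¬ (M ⊨ χ [ w ∷ ρ ])) (T M)
      skolem M (ex χ)  ρ = ε (λ w → M ⊨ χ [ w ∷ ρ ]) (T M)
      skolem M _       ρ = T M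

      skolem-all : ∀ (M : Structure PROP) {m} (χ : CorrFormula PROP (suc m)) ρ →
                   M ⊨ χ [ skolem M (all χ) ρ ∷ ρ ] → M ⊨ all χ [ ρ ]
      skolem-all M χ ρ h w = decidable-stable em₀ λ ¬h →
        ε-spec (λ w → ¬ (M ⊨ χ [ w ∷ ρ ])) (T M) (w , ¬h) h

      skolem-ex : ∀ (M : Structure PROP) {m} (χ : CorrFormula PROP (suc m)) ρ →
                  M ⊨ ex χ [ ρ ] → M ⊨ χ [ skolem M (ex χ) ρ ∷ ρ ]
      skolem-ex M χ ρ = ε-spec (λ w → M ⊨ χ [ w ∷ ρ ]) (T M)

      backForth : Family → (M N : Structure PROP) → W M → W N → W N → W M × W M
      backForth F M N x b c = ε
        (λ (b′ , c′) → R M x b′ c′ × Preserves F N M b b′ × Preserves F M N c′ c)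
        (T M , T M)

      module _ (P : Pair) (G : ℕ → Family) where

        eval  : ∀ {s} → Tm s → W (M P s)
        evals : ∀ {s m} → Vec (Tm s) m → Vec (W (M P s)) m
        eval {s} root      = pt P s
        eval {s} T′        = T (M P s)
        eval {s} (t ⋆)     = star (M P s) (eval t)
        eval {s} (sk σ ts) = skolem (M P s) (proj₂ (formula σ)) (evals ts)
        eval {s} (bf {s′ = s′} k i x b c) =
          (if k then proj₁ else proj₂)
            (backForth (G (suc i)) (M P s) (M P s′) (eval x) (eval b) (eval c))
        evals []       = []
        evals (t ∷ ts) = eval t ∷ evals ts

        Holds : Ground → Set ℓ
        Holds (holds s σ ts)     = M P s ⊨ proj₂ (formula σ) [ evals ts ]
        Holds (related s s′ i x y) = Preserves (G i) (M P s) (M P s′) (eval x) (eval y)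

      module _ (P : Pair) {G G′ : ℕ → Family} {n : ℕ} (G≡ : ∀ i → i ≤ n → G i ≡ G′ i) where

        eval-cong  : ∀ {s} (t : Tm s) → level t ≤ n → eval P G t ≡ eval P G′ t
        evals-cong : ∀ {s m} (ts : Vec (Tm s) m) → levels ts ≤ n → evals P G ts ≡ evals P G′ ts
        eval-cong root      l = refl
        eval-cong T′        l = refl
        eval-cong (t ⋆)     l = cong (star (M P _)) (eval-cong t l)
        eval-cong (sk σ ts) l = cong (skolem (M P _) (proj₂ (formula σ))) (evals-cong ts l)
        eval-cong (bf k i x b c) l
          rewrite G≡ (suc i) (m⊔n≤o⇒m≤o (suc i) (level x ⊔ (level b ⊔ level c)) l)
                | eval-cong x (m⊔n≤o⇒m≤o (level x) (level b ⊔ level c) (m⊔n≤o⇒n≤o (suc i) (level x ⊔ (level b ⊔ level c)) l))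
                | eval-cong b (m⊔n≤o⇒m≤o (level b) _ (m⊔n≤o⇒n≤o (level x) (level b ⊔ level c) (m⊔n≤o⇒n≤o (suc i) (level x ⊔ (level b ⊔ level c)) l)))
                | eval-cong c (m⊔n≤o⇒n≤o (level b) _ (m⊔n≤o⇒n≤o (level x) (level b ⊔ level c) (m⊔n≤o⇒n≤o (suc i) (level x ⊔ (level b ⊔ level c)) l)))
          = refl
        evals-cong []       l = refl
        evals-cong (t ∷ ts) l =
          cong₂ _∷_ (eval-cong t (m⊔n≤o⇒m≤o (level t) _ l)) (evals-cong ts (m⊔n≤o⇒n≤o (level t) _ l))

        Holds-cong : ∀ d → rank d ≤ n → Holds P G d ≡ Holds P G′ d
        Holds-cong (holds s σ ts) l = cong (M P s ⊨ proj₂ (formula σ) [_]) (evals-cong ts l)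
        Holds-cong (related s s′ i x y) l
          rewrite G≡ i (m⊔n≤o⇒m≤o i _ l)
                | eval-cong x (m⊔n≤o⇒m≤o (level x) _ (m⊔n≤o⇒n≤o i _ l))
                | eval-cong y (m⊔n≤o⇒n≤o (level x) _ (m⊔n≤o⇒n≤o i _ l))
          = refl

      -- Finite chains and their diagrams

      record Chain (n : ℕ) (P : Pair) (G : ℕ → Family) : Set (lsuc ℓ) where
        field
          base : Preserves (G 0) (M P true) (M P false) (pt P true) (pt P false)
          step : ∀ i → i < n → next (G (suc i)) ⊑ G i

      Diagram : Set ℓ
      Diagram = Ground → Bool

      Agree : ℕ → Diagram → Diagram → Set ℓ
      Agree n τ τ′ = ∀ d → rank d ≤ n → IsTrue (τ d) ⇔ IsTrue (τ′ d)

      -- `last` leaves room to prolong: a realiser for `next F` can be followed by `F`. Only ranks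
      -- up to `n` are prescribed, since others may consult families beyond the chain.
      record Realises (n : ℕ) (τ : Diagram) (F : Family) : Set (lsuc ℓ) where
        field
          P       : Pair
          G       : ℕ → Family
          chain   : Chain n P G
          last    : F ⊑ G n
          diagram : ∀ d → rank d ≤ n → IsTrue (τ d) ⇔ Holds P G d

      open Chain
      open Realises

      Realises-antitone : ∀ {n τ F F′} → F ⊑ F′ → Realises n τ F′ → Realises n τ F
      Realises-antitone F⊑F′ r = record
        { P = P r ; G = G r ; chain = chain r ; last = λ z → F⊑F′ (last r z) ; diagram = diagram r }

      extend : (ℕ → Family) → ℕ → Family → ℕ → Family
      extend G n F i with i ≤? n
      ... | yes _ = G i
      ... | no  _ = F

      extend-≤ : ∀ G n F i → i ≤ n → G i ≡ extend G n F i
      extend-≤ G n F i i≤n with i ≤? n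
      ... | yes _ = refl
      ... | no ¬p = contradiction i≤n ¬p

      extend-suc : ∀ G n F → F ≡ extend G n F (suc n)
      extend-suc G n F with suc n ≤? n
      ... | yes p = contradiction p 1+n≰n
      ... | no _  = refl

      diagramOf : Pair → (ℕ → Family) → Diagram
      diagramOf P G d = ⌊ em₀ {Holds P G d} ⌋

      diagramOf-spec : ∀ P G d → IsTrue (diagramOf P G d) ⇔ Holds P G d
      diagramOf-spec P G d = mk⇔ toWitness fromWitness

      Good : ℕ → Diagram → Set (lsuc ℓ)
      Good n τ = ∀ F → Realises n τ F

      -- Appending `F` to a realiser for `next F` does not affect statements of rank at most `n`.
      -- The new diagram depends on `F`; the pigeonhole principle makes one serve all families.
      good-suc : ∀ n τ → Good n τ → ∃ λ τ′ → Good (suc n) τ′ × Agree n τ τ′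
      good-suc n τ good =
        let τ′ , h = pigeonhole (λ τ′ F → Realises (suc n) τ′ F × Agree n τ τ′)
                       (λ F⊑G (r , a) → Realises-antitone F⊑G r , a) one
        -- Agreement does not mention the family, so the instance at `∅` provides it.
        in τ′ , proj₁ ∘ h , proj₂ (h ∅)
        where
        one : ∀ F → ∃ λ τ′ → Realises (suc n) τ′ F × Agree n τ τ′
        one F = diagramOf (P r) G′ ,
          record
            { P = P r ; G = G′
            ; chain = record { base = subst Base (G≡ 0 z≤n) (base (chain r)) ; step = step′ }
            ; last = subst (F ⊑_) (extend-suc (G r) n F) id
            ; diagram = λ d _ → diagramOf-spec (P r) G′ d } ,
          λ d l → ⇔-sym (diagramOf-spec (P r) G′ d) ⇔-∘
                  (subst (λ X → IsTrue (τ d) ⇔ X) (Holds-cong (P r) G≡ d l) (diagram r d l))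
          where
          r  = good (next F)
          G′ = extend (G r) n F
          G≡ = extend-≤ (G r) n F
          Base : Family → Set ℓ
          Base H = Preserves H (M (P r) true) (M (P r) false) (pt (P r) true) (pt (P r) false)
          step′ : ∀ i → i < suc n → next (G′ (suc i)) ⊑ G′ i
          step′ i (s≤s i≤n) with m≤n⇒m<n∨m≡n i≤n
          ... | inj₁ i<n  = subst₂ (λ A B → next A ⊑ B) (G≡ (suc i) i<n) (G≡ i i≤n) (step (chain r) i i<n)
          ... | inj₂ refl = subst₂ (λ A B → next A ⊑ B) (extend-suc (G r) n F) (G≡ n ≤-refl) (last r)

      good-zero : ¬ ∃ (EquivalentOver (Mod ψ) φ) → ∃ (Good 0)
      good-zero ¬θ = pigeonhole (Realises 0) Realises-antitone λ F →
        let P , z = decidable-stable em λ none → ¬θ (equivalent-if-separated F none)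
            G = λ _ → F
        in diagramOf P G , record
             { P = P ; G = G ; chain = record { base = z ; step = λ _ () }
             ; last = id ; diagram = λ d _ → diagramOf-spec P G d }

      -- Coherent sequences of chains

      record CoherentSequence : Set (lsuc ℓ) where
        field
          pair     : ℕ → Pair
          families : ℕ → ℕ → Family
          chains   : ∀ n → Chain n (pair n) (families n)
          coherent : ∀ d {m n} → rank d ≤ m → rank d ≤ n →
                     Holds (pair m) (families m) d → Holds (pair n) (families n) d

      -- Successive good diagrams agree on the ranks already settled, so choosing a realiser of each
      -- gives coherence, although the models at different stages may be unrelated.
      coherentSequence : ¬ ∃ (EquivalentOver (Mod ψ) φ) → CoherentSequence
      coherentSequence ¬θ = record
        { pair = P ∘ r ; families = G ∘ r ; chains = chain ∘ r
        ; coherent = λ d {m} {n} l l′ h →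
            to (diagram (r n) d l′) (to (stable d l l′) (from (diagram (r m) d l) h)) }
        where
        good : ∀ n → ∃ (Good n)
        good zero    = good-zero ¬θ
        good (suc n) = let τ , g = good n ; τ′ , g′ , _ = good-suc n τ g in τ′ , g′

        r : ∀ n → Realises n (proj₁ (good n)) ∅
        r n = proj₂ (good n) ∅

        increasing : ∀ {m n} → m ≤′ n → Agree m (proj₁ (good m)) (proj₁ (good n))
        increasing ≤′-refl d l = mk⇔ id id
        increasing (≤′-step {n} m≤n) d l =
          proj₂ (proj₂ (uncurry (good-suc n) (good n))) d (≤-trans l (≤′⇒≤ m≤n))
            ⇔-∘ increasing m≤n d l

        stable : ∀ d {m n} → rank d ≤ m → rank d ≤ n →
                 IsTrue (proj₁ (good m) d) ⇔ IsTrue (proj₁ (good n) d)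
        stable d {m} {n} l l′ with ≤-total m n
        ... | inj₁ m≤n = increasing (≤⇒≤′ m≤n) d l
        ... | inj₂ n≤m = ⇔-sym (increasing (≤⇒≤′ n≤m) d l′)

      -- The limit term models

      module Limit (C : CoherentSequence) where

        open CoherentSequence C

        𝔐 : ℕ → Bool → Structure PROP
        𝔐 n = M (pair n)

        E : ∀ n {s} → Tm s → W (𝔐 n s)
        E n = eval (pair n) (families n)

        Es : ∀ n {s m} → Vec (Tm s) m → Vec (W (𝔐 n s)) m
        Es n = evals (pair n) (families n)

        Holdsₙ : ℕ → Ground → Set ℓ
        Holdsₙ n = Holds (pair n) (families n)

        Sat : Ground → Set ℓ
        Sat d = Holdsₙ (rank d) d

        Sat⇔ : ∀ d {n} → rank d ≤ n → Sat d ⇔ Holdsₙ n d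
        Sat⇔ d l = mk⇔ (coherent d ≤-refl l) (coherent d l ≤-refl)

        infix 4 _≈_

        -- Equality is tested at the first stage that settles both terms; coherence carries it to
        -- every later one.
        record _≈_ {s} (t u : Tm s) : Set ℓ where
          constructor ⟨_⟩
          field
            E-≡ : E (level t ⊔ level u) t ≡ E (level t ⊔ level u) u

        open _≈_

        ≈⇔ : ∀ {s} {t u : Tm s} {n} → level t ≤ n → level u ≤ n → t ≈ u ⇔ E n t ≡ E n u
        ≈⇔ {s} {t} {u} lt lu = mk⇔
          (coherent d (bound lt₀ lu₀) (bound lt lu) ∘ E-≡)
          (⟨_⟩ ∘ coherent d (bound lt lu) (bound lt₀ lu₀))
          where
          lt₀ = m≤m⊔n (level t) (level u)
          lu₀ = m≤n⊔m (level t) (level u)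
          d = holds s (≐-axis , nothing) (t ∷ u ∷ [])
          bound : ∀ {n} → level t ≤ n → level u ≤ n → rank d ≤ n
          bound lt lu = ⊔-lub lt (⊔-lub lu z≤n)

        ≈-sym : ∀ {s} {t u : Tm s} → t ≈ u → u ≈ t
        ≈-sym {t = t} {u} ⟨ e ⟩ =
          from (≈⇔ (m≤n⊔m (level t) (level u)) (m≤m⊔n (level t) (level u))) (sym e)

        ≈-trans : ∀ {s} {t u v : Tm s} → t ≈ u → u ≈ v → t ≈ v
        ≈-trans {t = t} {u} {v} e e′ = from (≈⇔ lt lv) (trans (to (≈⇔ lt lu) e) (to (≈⇔ lu lv) e′))
          where
          lt = m≤m⊔n (level t) (level u ⊔ level v)
          lu = ≤-trans (m≤m⊔n (level u) (level v)) (m≤n⊔m (level t) (level u ⊔ level v))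
          lv = ≤-trans (m≤n⊔m (level u) (level v)) (m≤n⊔m (level t) (level u ⊔ level v))

        -- Canonical representatives of ≈-classes: a class is determined by the
        -- least stage n with a term of the class, and the element of 𝔐 n this
        -- term denotes; the representative is chosen as a function of these.
        -- (A choice from the class as a predicate would need extensionality.)

        Near : ∀ {s} → Tm s → Pred ℕ ℓ
        Near t n = ∃ λ u → level u ≤ n × t ≈ u

        canonical : ∀ n {s} → W (𝔐 n s) → Tm s
        canonical n e = ε (λ u → level u ≤ n × E n u ≡ e) root

        nearest : ∀ {s} (t : Tm s) → ∃ (Least (Near t))
        nearest t = least (Near t) (level t) (t , ≤-refl , ⟨ refl ⟩)

        abstract
          rep : ∀ {s} → Tm s → Tm s
          rep t = let n , (u , _) , _ = nearest t in canonical n (E n u)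

          -- Leastness bounds the level, as `t` lies in its own class; hence passing to
          -- representatives never requires a later stage.
          rep-spec : ∀ {s} (t : Tm s) → level (rep t) ≤ level t × t ≈ rep t
          rep-spec t =
            let n , (u , l , t≈u) , min = nearest t
                l′ , e = ε-spec (λ v → level v ≤ n × E n v ≡ E n u) root (u , l , refl)
            in ≤-trans l′ (min (level t) (t , ≤-refl , ⟨ refl ⟩)) ,
               ≈-trans t≈u (from (≈⇔ l l′) (sym e))

          -- The least stages of equivalent terms are only provably equal. With the stages as
          -- variables this equation can be matched away, after which the denotations coincide.
          canonical-unique : ∀ {s} {t u t′ u′ : Tm s} {m n} → t ≈ u → t ≈ t′ → u ≈ u′ →
            level t′ ≤ m → level u′ ≤ n → m ≡ n → canonical m (E m t′) ≡ canonical n (E n u′)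
          canonical-unique t≈u t≈t′ u≈u′ l l′ refl =
            cong (canonical _) (to (≈⇔ l l′) (≈-trans (≈-sym t≈t′) (≈-trans t≈u u≈u′)))

          rep-cong : ∀ {s} {t u : Tm s} → t ≈ u → rep t ≡ rep u
          rep-cong {t = t} {u} t≈u =
            let m , (t′ , l , t≈t′) , min = nearest t
                n , (u′ , l′ , u≈u′) , min′ = nearest u
            in canonical-unique t≈u t≈t′ u≈u′ l l′
                 (≤-antisym (min n (u′ , l′ , ≈-trans t≈u u≈u′))
                            (min′ m (t′ , l , ≈-trans (≈-sym t≈u) t≈t′)))

        -- The quotient by `≈`, realised as the fixed points of `rep`, so that `≐` can be
        -- interpreted by `≡`.
        Domain : Bool → Set ℓ
        Domain s = Σ (Tm s) λ t → rep t ≡ t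

        Domain-≡ : ∀ {s} {x y : Domain s} → proj₁ x ≡ proj₁ y → x ≡ y
        Domain-≡ {x = t , p} {.t , q} refl = cong (t ,_) (≡-irrelevant p q)

        cls : ∀ {s} → Tm s → Domain s
        cls t = rep t , rep-cong (≈-sym (proj₂ (rep-spec t)))

        cls-cong : ∀ {s} {t u : Tm s} → t ≈ u → cls t ≡ cls u
        cls-cong t≈u = Domain-≡ (rep-cong t≈u)

        cls-proj₁ : ∀ {s} (x : Domain s) → cls (proj₁ x) ≡ x
        cls-proj₁ (t , p) = Domain-≡ p

        E-rep : ∀ {s} (t : Tm s) {n} → level t ≤ n → E n (rep t) ≡ E n t
        E-rep t l = let l′ , e = rep-spec t in sym (to (≈⇔ l (≤-trans l′ l)) e)

        level-rep : ∀ {s} (t : Tm s) {n} → level t ≤ n → level (rep t) ≤ n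
        level-rep t l = ≤-trans (proj₁ (rep-spec t)) l

        cls-≡⇔ : ∀ {s} {t u : Tm s} {n} → level t ≤ n → level u ≤ n → cls t ≡ cls u ⇔ E n t ≡ E n u
        cls-≡⇔ {t = t} {u} lt lu = mk⇔
          (λ e → trans (sym (E-rep t lt)) (trans (cong (E _ ∘ proj₁) e) (E-rep u lu)))
          (λ e → cls-cong (from (≈⇔ lt lu) e))

        ℳ : Bool → Structure PROP
        ℳ s = record
          { W    = Domain s
          ; R    = λ (x , _) (y , _) (z , _) → Sat (holds s (R-axis , nothing) (x ∷ y ∷ z ∷ []))
          ; star = λ (x , _) → cls (x ⋆)
          ; T    = cls T′
          ; V    = λ p (x , _) → Sat (holds s (V-axis p , nothing) (x ∷ []))
          }

        star-cls : ∀ {s} (t : Tm s) → star (ℳ s) (cls t) ≡ cls (t ⋆)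
        star-cls {s} t = from (cls-≡⇔ (level-rep t ≤-refl) ≤-refl)
                              (cong (star (𝔐 (level t) s)) (E-rep t ≤-refl))

        R⇔ : ∀ {s} (t u v : Tm s) {n} → level t ≤ n → level u ≤ n → level v ≤ n →
             R (ℳ s) (cls t) (cls u) (cls v) ⇔ R (𝔐 n s) (E n t) (E n u) (E n v)
        R⇔ {s} t u v {n} lt lu lv
          rewrite sym (E-rep t lt) | sym (E-rep u lu) | sym (E-rep v lv) =
          Sat⇔ (holds s (R-axis , nothing) (rep t ∷ rep u ∷ rep v ∷ []))
               (⊔-lub (level-rep t lt) (⊔-lub (level-rep u lu) (⊔-lub (level-rep v lv) z≤n)))

        V⇔ : ∀ {s} p (t : Tm s) {n} → level t ≤ n → cls t ∈ V (ℳ s) p ⇔ E n t ∈ V (𝔐 n s) p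
        V⇔ {s} p t {n} l rewrite sym (E-rep t l) =
          Sat⇔ (holds s (V-axis p , nothing) (rep t ∷ [])) (⊔-lub (level-rep t l) z≤n)

        -- Truth in the limit

        -- What the quantifier cases of `truth` use: the truth of a subformula at terms is
        -- independent of the stage once their levels are reached, and its Skolem value is denoted
        -- by a term of the same level as the arguments.
        record Closed (χ : ∃ (CorrFormula PROP)) : Set ℓ where
          field
            transfer : ∀ {s} (ts : Vec (Tm s) (proj₁ χ)) {m n} → levels ts ≤ m → levels ts ≤ n →
                       𝔐 m s ⊨ proj₂ χ [ Es m ts ] → 𝔐 n s ⊨ proj₂ χ [ Es n ts ]
            witness  : ∀ {s} (ts : Vec (Tm s) (proj₁ χ)) → ∃ λ u → level u ≡ levels ts ×
                       (∀ n → E n u ≡ skolem (𝔐 n s) (proj₂ χ) (Es n ts))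

        open Closed

        formula-closed : ∀ σ → Closed (formula σ)
        formula-closed σ = record
          { transfer = λ ts → coherent (holds _ σ ts)
          ; witness  = λ ts → sk σ ts , refl , λ _ → refl }

        inst : ∀ {s m} → Vec (Tm s) m → Term m → Tm s
        inst ts (var i) = lookup ts i
        inst ts cst     = T′
        inst ts (a *)   = inst ts a ⋆

        level-lookup : ∀ {s m} (ts : Vec (Tm s) m) i → level (lookup ts i) ≤ levels ts
        level-lookup (t ∷ ts) zero    = m≤m⊔n _ _
        level-lookup (t ∷ ts) (suc i) = ≤-trans (level-lookup ts i) (m≤n⊔m (level t) _)

        level-inst : ∀ {s m} (ts : Vec (Tm s) m) a {n} → levels ts ≤ n → level (inst ts a) ≤ n
        level-inst ts (var i) l = ≤-trans (level-lookup ts i) l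
        level-inst ts cst     l = z≤n
        level-inst ts (a *)   l = level-inst ts a l

        E-lookup : ∀ {s m} (ts : Vec (Tm s) m) i n → E n (lookup ts i) ≡ lookup (Es n ts) i
        E-lookup (t ∷ ts) zero    n = refl
        E-lookup (t ∷ ts) (suc i) n = E-lookup ts i n

        E-inst : ∀ {s m} (ts : Vec (Tm s) m) a n → E n (inst ts a) ≡ ⟦ a ⟧ (𝔐 n s) (Es n ts)
        E-inst ts (var i) n = E-lookup ts i n
        E-inst ts cst     n = refl
        E-inst ts (a *)   n = cong (star (𝔐 n _)) (E-inst ts a n)

        cls-inst : ∀ {s m} (ts : Vec (Tm s) m) a → cls (inst ts a) ≡ ⟦ a ⟧ (ℳ s) (map cls ts)
        cls-inst ts (var i) = sym (lookup-map i cls ts)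
        cls-inst ts cst     = refl
        cls-inst {s} ts (a *) = trans (sym (star-cls (inst ts a))) (cong (star (ℳ s)) (cls-inst ts a))

        truth : ∀ {m} (χ : CorrFormula PROP m) → (∀ q → Closed (subformula χ q)) →
                ∀ {s} (ts : Vec (Tm s) m) {n} → levels ts ≤ n →
                (ℳ s ⊨ χ [ map cls ts ]) ⇔ (𝔐 n s ⊨ χ [ Es n ts ])
        truth (a ≐ b) cl ts {n} l
          rewrite sym (cls-inst ts a) | sym (cls-inst ts b)
                | sym (E-inst ts a n) | sym (E-inst ts b n) =
          cls-≡⇔ (level-inst ts a l) (level-inst ts b l)
        truth (rel a b c) cl ts {n} l
          rewrite sym (cls-inst ts a) | sym (cls-inst ts b) | sym (cls-inst ts c)
                | sym (E-inst ts a n) | sym (E-inst ts b n) | sym (E-inst ts c n) =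
          R⇔ (inst ts a) (inst ts b) (inst ts c)
             (level-inst ts a l) (level-inst ts b l) (level-inst ts c l)
        truth (prd p a) cl ts {n} l
          rewrite sym (cls-inst ts a) | sym (E-inst ts a n) =
          V⇔ p (inst ts a) (level-inst ts a l)
        truth (neg χ) cl ts l =
          let ih = truth χ (cl ∘ just) ts l in mk⇔ (λ h → h ∘ from ih) (λ h → h ∘ to ih)
        truth (⋀ χ) cl ts l =
          let ih = λ i → truth (χ i) (λ q → cl (just (i , q))) ts l
          in mk⇔ (λ h i → to (ih i) (h i)) (λ h i → from (ih i) (h i))
        truth (⋁ χ) cl ts l =
          let ih = λ i → truth (χ i) (λ q → cl (just (i , q))) ts l
          in mk⇔ (λ (i , h) → i , to (ih i) h) (λ (i , h) → i , from (ih i) h)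
        truth (all χ) cl {s} ts {n} l = mk⇔
          (λ h →
            let u , lu , e = witness (cl nothing) ts
            in skolem-all (𝔐 n s) χ (Es n ts)
                 (subst (λ w → 𝔐 n s ⊨ χ [ w ∷ Es n ts ]) (e n)
                   (to (truth χ (cl ∘ just) (u ∷ ts) (⊔-lub (subst (_≤ n) (sym lu) l) l)) (h (cls u)))))
          -- The level of `x` may exceed `n`, so the universal statement is first transferred to a
          -- stage that covers `x`.
          (λ h x →
            let t = proj₁ x
                l′ = m≤n⊔m (level t) (levels ts)
            in subst (λ w → ℳ s ⊨ χ [ w ∷ map cls ts ]) (cls-proj₁ x)
                 (from (truth χ (cl ∘ just) (t ∷ ts) ≤-refl)
                   (transfer (cl nothing) ts l l′ h (E _ t))))
        truth (ex χ) cl {s} ts {n} l = mk⇔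
          (λ (x , h) →
            let t = proj₁ x
                l′ = m≤n⊔m (level t) (levels ts)
            in transfer (cl nothing) ts l′ l
                 (E _ t , to (truth χ (cl ∘ just) (t ∷ ts) ≤-refl)
                   (subst (λ w → ℳ s ⊨ χ [ w ∷ map cls ts ]) (sym (cls-proj₁ x)) h)))
          (λ h →
            let u , lu , e = witness (cl nothing) ts
            in cls u , from (truth χ (cl ∘ just) (u ∷ ts) (⊔-lub (subst (_≤ n) (sym lu) l) l))
                 (subst (λ w → 𝔐 n s ⊨ χ [ w ∷ Es n ts ]) (sym (e n)) (skolem-ex (𝔐 n s) χ (Es n ts) h)))

        ℳ∈K : ∀ s → ℳ s ∈ Mod ψ
        ℳ∈K s = from (truth ψ (λ q → formula-closed (ψ-axis , q)) [] {0} z≤n) (M∈K (pair 0) s)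

        φ⇔ : ∀ s → (ℳ s ⊨ φ [ cls root ∷ [] ]) ⇔ (𝔐 0 s ⊨ φ [ pt (pair 0) s ∷ [] ])
        φ⇔ s = truth φ (λ q → formula-closed (φ-axis , q)) (root ∷ []) z≤n

        -- The directed bisimulation

        -- The union of the infinite chain. Each back-and-forth move raises the index by one, which
        -- the union absorbs.
        record Z s s′ (x : Domain s) (y : Domain s′) : Set ℓ where
          constructor stage
          field
            index  : ℕ
            at     : Sat (related s s′ index (proj₁ x) (proj₁ y))

        Z-intro : ∀ {s s′} i (t : Tm s) (u : Tm s′) {n} → i ≤ n → level t ≤ n → level u ≤ n →
                  Holdsₙ n (related s s′ i t u) → Z s s′ (cls t) (cls u)
        Z-intro {s} {s′} i t u {n} li lt lu h = stage i
          (from (Sat⇔ (related s s′ i (rep t) (rep u))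
                 (⊔-lub li (⊔-lub (level-rep t lt) (level-rep u lu))))
            (subst₂ (Preserves (families n i) (𝔐 n s) (𝔐 n s′)) (sym (E-rep t lt)) (sym (E-rep u lu)) h))

        Z-next : ∀ {s s′} i (x : Tm s) (y : Tm s′) {n} → i < n → level x ≤ n → level y ≤ n →
                 Sat (related s s′ i x y) →
                 Preserves (next (families n (suc i))) (𝔐 n s) (𝔐 n s′) (E n x) (E n y)
        Z-next {s} {s′} i x y {n} li lx ly h =
          step (chains n) i li
            (to (Sat⇔ (related s s′ i x y) (⊔-lub (<⇒≤ li) (⊔-lub lx ly))) h)

        directed : ∀ s s′ → Directed (ℳ s) (ℳ s′) (Z s s′) (Z s′ s)
        directed s s′ = record
          { star-back = λ {(x , _)} {(y , _)} (stage i h) →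
              let n , li , lx , ly = stageFor i x y
              in Z-intro (suc i) (y ⋆) (x ⋆) li ly lx
                   (next-star (families n (suc i)) (Z-next i x y li lx ly h))
          ; R-back = λ {x} {y} {b} {c} → R-back {x} {y} {b} {c}
          ; atoms = λ {x} {y} (stage i h) p v →
              let n , li , lx , ly = stageFor i (proj₁ x) (proj₁ y)
              in subst (_∈ V (ℳ s′) p) (cls-proj₁ y) (from (V⇔ p (proj₁ y) ly)
                   (Z-next i (proj₁ x) (proj₁ y) li lx ly h (atomᵢ p)
                     (to (V⇔ p (proj₁ x) lx) (subst (_∈ V (ℳ s) p) (sym (cls-proj₁ x)) v))))
          }
          where
          -- The strict `i < n` matters: a chain of length `n` provides a step out of relation `i`
          -- only then.
          stageFor : ∀ i (t : Tm s) (u : Tm s′) → ∃ λ n → i < n × level t ≤ n × level u ≤ n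
          stageFor i t u = suc i ⊔ (level t ⊔ level u) ,
            m≤m⊔n (suc i) (level t ⊔ level u) ,
            ≤-trans (m≤m⊔n (level t) (level u)) (m≤n⊔m (suc i) (level t ⊔ level u)) ,
            ≤-trans (m≤n⊔m (level t) (level u)) (m≤n⊔m (suc i) (level t ⊔ level u))

          R-back : ∀ {x y b c} → Z s s′ x y → R (ℳ s′) y b c →
                   ∃₂ λ b′ c′ → R (ℳ s) x b′ c′ × Z s′ s b b′ × Z s s′ c′ c
          R-back {x} {y} {b} {c} (stage i h) Rybc =
            cls b′ , cls c′ ,
            subst (λ w → R (ℳ s) w (cls b′) (cls c′)) (cls-proj₁ x)
              (from (R⇔ x₀ b′ c′ lx lb′ lb′) Rxb′c′) ,
            subst (λ w → Z s′ s w (cls b′)) (cls-proj₁ b) (Z-intro (suc i) b₀ b′ li lb lb′ zb) ,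
            subst (Z s s′ (cls c′)) (cls-proj₁ c) (Z-intro (suc i) c′ c₀ li lb′ lc zc)
            where
            x₀ = proj₁ x
            y₀ = proj₁ y
            b₀ = proj₁ b
            c₀ = proj₁ c
            -- The two terms project the same chosen pair, so at a common stage they denote
            -- witnesses that fit together.
            b′ c′ : Tm s
            b′ = bf true i x₀ b₀ c₀
            c′ = bf false i x₀ b₀ c₀
            n = level b′ ⊔ level y₀
            lb′ : level b′ ≤ n
            lb′ = m≤m⊔n _ _
            ly : level y₀ ≤ n
            ly = m≤n⊔m (level b′) _
            li : suc i ≤ n
            li = m⊔n≤o⇒m≤o (suc i) (level x₀ ⊔ (level b₀ ⊔ level c₀)) lb′
            lxbc : level x₀ ⊔ (level b₀ ⊔ level c₀) ≤ n
            lxbc = m⊔n≤o⇒n≤o (suc i) _ lb′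
            lx : level x₀ ≤ n
            lx = m⊔n≤o⇒m≤o (level x₀) _ lxbc
            lb : level b₀ ≤ n
            lb = m⊔n≤o⇒m≤o (level b₀) _ (m⊔n≤o⇒n≤o (level x₀) _ lxbc)
            lc : level c₀ ≤ n
            lc = m⊔n≤o⇒n≤o (level b₀) _ (m⊔n≤o⇒n≤o (level x₀) _ lxbc)
            Rₙ : R (𝔐 n s′) (E n y₀) (E n b₀) (E n c₀)
            Rₙ = to (Sat⇔ (holds s′ (R-axis , nothing) (y₀ ∷ b₀ ∷ c₀ ∷ []))
                      (⊔-lub ly (⊔-lub lb (⊔-lub lc z≤n)))) Rybc
            spec = ε-spec _ _ (next-R (families n (suc i)) (Z-next i x₀ y₀ li lx ly h) Rₙ)
            Rxb′c′ = proj₁ spec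
            zb = proj₁ (proj₂ spec)
            zc = proj₂ (proj₂ spec)

        Z-base : Z true false (cls root) (cls root)
        Z-base = Z-intro 0 root root {0} z≤n z≤n z≤n (base (chains 0))

        bisimulation : IsRelevantDirectedBisimulation (ℳ true) (ℳ false) (Z true false) (Z false true)
        bisimulation = record
          { nonempty₁ = _ , _ , Z-base
          ; nonempty₂ = _ , _ , Directed.star-back (directed true false) Z-base
          ; directed₁ = directed true false
          ; directed₂ = directed false true
          }

        not-preserved : ¬ PreservedUnderRelevantDirectedBisimulations (Mod ψ) φ
        not-preserved pres = φ-false (pair 0) (to (φ⇔ false)
          (proj₁ (pres (ℳ∈K true) (ℳ∈K false) bisimulation) Z-base
            (from (φ⇔ true) (φ-true (pair 0)))))

corollary14 : ∀ {ℓ : Level} → ExcludedMiddle (lsuc ℓ) →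
    (PROP : Set ℓ) (ψ : CorrFormula PROP 0) (φ : CorrFormula PROP 1) →
    PreservedUnderRelevantDirectedBisimulations (Mod ψ) φ
    ⇔ (∃ λ (θ : RelevantFormula PROP) → EquivalentOver (Mod ψ) φ θ)
corollary14 em PROP ψ φ = mk⇔ {A = PreservedUnderRelevantDirectedBisimulations (Mod ψ) φ}
  (λ pres → decidable-stable em λ ¬θ →
    Limit.not-preserved em ψ φ (coherentSequence em ψ φ ¬θ) pres)
  (λ (θ , φ⇔θ) {M₁} {M₂} M₁∈K M₂∈K bisim →
    let open IsRelevantDirectedBisimulation bisim in
    (λ z h → from (φ⇔θ M₂ M₂∈K _)
      (relevant-preserved θ directed₁ directed₂ z (to (φ⇔θ M₁ M₁∈K _) h))) ,
    (λ z h → from (φ⇔θ M₁ M₁∈K _)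
      (relevant-preserved θ directed₂ directed₁ z (to (φ⇔θ M₂ M₂∈K _) h))))
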